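{- Let $k$ be a non-negative integer and let $t\in\{0,\ldots,k-1\}$ be even. Then \[ m_1(2k,k,t)\le 2\cdot\binom{2k-t-1}{k}=2\cdot\binom{2k-t-1}{k-t-1}. \]
   Context: For a finite set $V$ of size $n$, $\binom{V}{k}$ is the set of all $k$-element subsets of $V$. For $T\subseteq V$ with $\#T=t$, the $t$-pencil focussed at $T$ is the characteristic function of $\{K\in\binom{V}{k}\mid T\subseteq K\}$. The degree of a non-zero function $f:\binom{V}{k}\to\mathbb{R}$ is the smallest $t$ such that $f$ is an $\mathbb{R}$-linear combination of $t$-pencils; the degree of the zero function is $-\infty$. A function $f$ is Boolean if it takes only the values $0$ and $1$; its size is $\#f=\sum_{K}f(K)$. For non-negative integers $t$ and $k\le n$, $m_1(n,k,t)$ denotes the minimum size of a non-zero Boolean function $\binom{V}{k}\to\{0,1\}$ of degree at most $t$, where $\#V=n$. -}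

module Defs where

open import Algebra.Apartness.Bundles using (HeytingCommutativeRing; HeytingField)
import Algebra.Apartness.Properties.HeytingCommutativeRing as HCR
open import Algebra.Bundles using (CommutativeRing)
import Algebra.Definitions.RawMonoid as RawMonoid
open import Data.Bool.Base using (Bool; true; false; if_then_else_)
open import Data.Fin.Subset using (Subset; inside; outside; ∣_∣; _⊆_; ⊥)
open import Data.Fin.Subset.Properties using (_⊆?_; ⊥⊆)
open import Data.List.Base as List using (List; []; _∷_; [_]; _++_)
open import Data.List.Membership.Propositional using (_∈_)
open import Data.List.Membership.Propositional.Properties
  using (∈-map⁺; ∈-map⁻; ∈-++⁺ˡ; ∈-++⁺ʳ)
open import Data.List.Relation.Unary.All using ([])
open import Data.List.Relation.Unary.Any using (here)
open import Data.List.Relation.Unary.Unique.Propositional using (Unique; []; _∷_)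
open import Data.List.Relation.Unary.Unique.Propositional.Properties using (map⁺; ++⁺)
open import Data.Nat.Base as ℕ using (ℕ; zero; suc; z≤n; s≤s)
open import Data.Nat.Induction using (<-rec)
import Data.Nat.Properties as ℕ
open import Data.Product.Base using (Σ; ∃; _×_; _,_; proj₁; proj₂)
open import Data.Sum.Base using (_⊎_)
import Data.Vec.Base as Vec
open import Function.Base using (case_of_)
open import Level using (Level; _⊔_) renaming (suc to lsuc)
open import Relation.Binary.Construct.Add.Infimum.NonStrict ℕ._≤_ using (_≤₋_; ⊥₋≤_)
  renaming ([_] to ≤₋[_])
open import Relation.Binary.Core using (Rel)
open import Relation.Binary.PropositionalEquality as ≡ using (_≡_; refl; cong)
open import Relation.Binary.Structures using (IsStrictPartialOrder)
open import Relation.Nullary using (¬_; does; contradiction)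
open import Relation.Nullary.Construct.Add.Infimum using (_₋; ⊥₋)
  renaming ([_] to fin[_])
open import Relation.Nullary.Decidable using (dec-true)

-- ℝ is given by its axioms: an Archimedean, Cauchy-complete ordered field.
-- Classically these determine ℝ up to isomorphism; the constructive form
-- (apartness, and a modulus carried by every Cauchy sequence and limit) also
-- admits Bishop's reals as a model.
record RealField c ℓ₁ ℓ₂ : Set (lsuc (c ⊔ ℓ₁ ⊔ ℓ₂)) where
  field
    heytingField : HeytingField c ℓ₁ ℓ₂

  open HeytingField heytingField public
  open HeytingCommutativeRing heytingCommutativeRing public using (commutativeRing)
  open CommutativeRing commutativeRing using (+-rawMonoid)
  open RawMonoid +-rawMonoid public using () renaming (_×_ to _·_)

  infix 4 _<_ ∣_∣<_
  field
    _<_                    : Rel Carrier ℓ₂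
    <-isStrictPartialOrder : IsStrictPartialOrder _≈_ _<_
    <⇒#                    : ∀ {x y} → x < y → x # y
    #⇒<⊎>                  : ∀ {x y} → x # y → x < y ⊎ y < x
    +-monoˡ-<              : ∀ {x y} z → x < y → (x + z) < (y + z)
    *-pos                  : ∀ {x y} → 0# < x → 0# < y → 0# < (x * y)
    archimedean            : ∀ x → ∃ λ n → x < (n · 1#)

  ∣_∣<_ : Rel Carrier ℓ₂
  ∣ x ∣< ε = (- ε) < x × x < ε

  Cauchy : (ℕ → Carrier) → Set (c ⊔ ℓ₂)
  Cauchy a = ∀ ε → 0# < ε →
    ∃ λ N → ∀ i j → N ℕ.≤ i → N ℕ.≤ j → ∣ a i - a j ∣< ε

  _ConvergesTo_ : (ℕ → Carrier) → Carrier → Set (c ⊔ ℓ₂)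
  a ConvergesTo x = ∀ ε → 0# < ε →
    ∃ λ N → ∀ i → N ℕ.≤ i → ∣ a i - x ∣< ε

  field
    complete : ∀ a → Cauchy a → ∃ λ x → a ConvergesTo x

IsMinimum : ∀ {p} → (ℕ → Set p) → ℕ → Set p
IsMinimum P m = P m × (∀ s → P s → m ℕ.≤ s)

¬¬minimum : ∀ {p} (P : ℕ → Set p) {s} → P s → ¬ ¬ ∃ (IsMinimum P)
¬¬minimum P {s} Ps ¬min =
  <-rec (λ i → ¬ P i)
    (λ i below Pi → ¬min (i , Pi , λ j Pj → ℕ.≮⇒≥ λ j<i → below j<i Pj))
    s Ps

KSubset : ℕ → ℕ → Set
KSubset n k = Σ (Subset n) λ K → ∣ K ∣ ≡ k

with-0 : ∀ {n k} → KSubset n k → KSubset (suc n) (suc k)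
with-0 (K , eq) = inside Vec.∷ K , cong suc eq

without-0 : ∀ {n k} → KSubset n k → KSubset (suc n) k
without-0 (K , eq) = outside Vec.∷ K , eq

kSubsets : ∀ n k → List (KSubset n k)
kSubsets zero    zero    = [ Vec.[] , refl ]
kSubsets zero    (suc k) = []
kSubsets (suc n) zero    = List.map without-0 (kSubsets n zero)
kSubsets (suc n) (suc k) =
  List.map with-0 (kSubsets n k) ++ List.map without-0 (kSubsets n (suc k))

kSubsets-complete : ∀ {n k} (K : KSubset n k) → K ∈ kSubsets n k
kSubsets-complete {zero}  {zero}  (Vec.[] , refl) = here refl
kSubsets-complete {suc n} {zero}  (outside Vec.∷ K , eq) =
  ∈-map⁺ without-0 (kSubsets-complete (K , eq))
kSubsets-complete {suc n} {suc k} (outside Vec.∷ K , eq) =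
  ∈-++⁺ʳ _ (∈-map⁺ without-0 (kSubsets-complete (K , eq)))
kSubsets-complete {suc n} {suc _} (inside Vec.∷ K , refl) =
  ∈-++⁺ˡ (∈-map⁺ with-0 (kSubsets-complete (K , refl)))

KSubset-≡ : ∀ {n k} {K L : KSubset n k} → proj₁ K ≡ proj₁ L → K ≡ L
KSubset-≡ {K = K , p} {.K , q} refl = cong (K ,_) (ℕ.≡-irrelevant p q)

kSubsets-unique : ∀ n k → Unique (kSubsets n k)
kSubsets-unique zero    zero    = [] ∷ []
kSubsets-unique zero    (suc k) = []
kSubsets-unique (suc n) zero    =
  map⁺ (λ eq → KSubset-≡ (cong (λ L → Vec.tail (proj₁ L)) eq)) (kSubsets-unique n zero)
kSubsets-unique (suc n) (suc k) = ++⁺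
  (map⁺ (λ eq → KSubset-≡ (cong (λ L → Vec.tail (proj₁ L)) eq)) (kSubsets-unique n k))
  (map⁺ (λ eq → KSubset-≡ (cong (λ L → Vec.tail (proj₁ L)) eq)) (kSubsets-unique n (suc k)))
  λ (p , q) → case ∈-map⁻ with-0 p of λ where
    (_ , _ , refl) → case ∈-map⁻ without-0 q of λ where
      (_ , _ , ())

size : ∀ {n k} → (KSubset n k → Bool) → ℕ
size {n} {k} f = List.sum (List.map (λ K → if f K then 1 else 0) (kSubsets n k))

module _ {c ℓ₁ ℓ₂} (ℝ : RealField c ℓ₁ ℓ₂) where

  open RealField ℝ
    using (Carrier; _≈_; 0#; 1#; _+_; _*_; *-identityˡ; +-identityʳ; sym; trans)

  Function : ℕ → ℕ → Set c
  Function n k = KSubset n k → Carrier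

  pencil : ∀ {n k t} → KSubset n t → Function n k
  pencil (T , _) (K , _) = if does (T ⊆? K) then 1# else 0#

  sum : ∀ {a} {A : Set a} → (A → Carrier) → List A → Carrier
  sum f xs = List.foldr (λ x s → f x + s) 0# xs

  IsPencilCombination : ∀ {n k} → Function n k → ℕ → Set (c ⊔ ℓ₁)
  IsPencilCombination {n} {k} f t =
    ∃ λ (a : KSubset n t → Carrier) →
      ∀ K → f K ≈ sum (λ T → a T * pencil T K) (kSubsets n t)

  IsZero : ∀ {n k} → Function n k → Set ℓ₁
  IsZero f = ∀ K → f K ≈ 0#

  -- ⊥₋ plays the role of -∞.
  data HasDegree {n k} (f : Function n k) : ℕ ₋ → Set (c ⊔ ℓ₁) where
    zero    : IsZero f → HasDegree f ⊥₋
    nonZero : ∀ {d} → ¬ IsZero f → IsMinimum (IsPencilCombination f) d →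
              HasDegree f fin[ d ]

  DegreeAtMost : ∀ {n k} → Function n k → ℕ → Set (c ⊔ ℓ₁)
  DegreeAtMost f t = ∃ λ d → HasDegree f d × d ≤₋ fin[ t ]

  ⟦_⟧ : ∀ {n k} → (KSubset n k → Bool) → Function n k
  ⟦ f ⟧ K = if f K then 1# else 0#

  IsSize : ℕ → ℕ → ℕ → ℕ → Set (c ⊔ ℓ₁)
  IsSize n k t s = ∃ λ (f : KSubset n k → Bool) →
    ¬ IsZero ⟦ f ⟧ × DegreeAtMost ⟦ f ⟧ t × size f ≡ s

  -- The minimum is a relation rather than a function: finding it would
  -- require deciding equality of reals.  ¬¬m₁ shows that it exists classically.
  IsM₁ : ℕ → ℕ → ℕ → ℕ → Set (c ⊔ ℓ₁)
  IsM₁ n k t = IsMinimum (IsSize n k t)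

  private
    kSubset : ∀ {n k} → k ℕ.≤ n → KSubset n k
    kSubset {zero}  z≤n       = Vec.[] , refl
    kSubset {suc n} z≤n       = without-0 (kSubset z≤n)
    kSubset         (s≤s k≤n) = with-0 (kSubset k≤n)

    kSubsets-0 : ∀ n → ∃ λ eq → kSubsets n 0 ≡ [ ⊥ , eq ]
    kSubsets-0 zero    = refl , refl
    kSubsets-0 (suc n) with eq , p ← kSubsets-0 n = eq , cong (List.map without-0) p

    1≉0 : ¬ 1# ≈ 0#
    1≉0 1≈0 = RealField.#-irrefl ℝ 1≈0 (HCR.1#0 (RealField.heytingCommutativeRing ℝ))

    one-combination : ∀ n k → IsPencilCombination {n} {k} (λ _ → 1#) 0
    one-combination n k = (λ _ → 1#) , λ (K , q) → aux K q (kSubsets-0 n)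
      where
      aux : ∀ (K : Subset n) (q : ∣ K ∣ ≡ k) → (∃ λ eq → kSubsets n 0 ≡ [ ⊥ , eq ]) →
            1# ≈ sum (λ T → 1# * pencil T (K , q)) (kSubsets n 0)
      aux K q (eq , p) rewrite p | dec-true (⊥ ⊆? K) ⊥⊆ =
        sym (trans (+-identityʳ _) (*-identityˡ _))

  ¬¬m₁ : ∀ {n k} t → k ℕ.≤ n → ¬ ¬ ∃ (IsM₁ n k t)
  ¬¬m₁ {n} {k} t k≤n = ¬¬minimum (IsSize n k t)
    ( (λ _ → true) , one≢0
    , (fin[ 0 ] , nonZero one≢0 (one-combination n k , λ _ _ → z≤n) , ≤₋[ z≤n ])
    , refl )
    where
    one≢0 : ¬ IsZero {n} {k} (λ _ → 1#)
    one≢0 p = 1≉0 (p (kSubset k≤n))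

{-# OPTIONS --safe #-}

-- Let T have t + 1 elements and let f be the characteristic function of
-- {K ∣ T ⊆ K or T ∩ K = ∅}.  By inclusion-exclusion [T ∩ K = ∅] is the
-- alternating sum of the pencils [S ⊆ K] over S ⊆ T; for even t the term S = T
-- is −[T ⊆ K], so f is a combination of pencils focussed at at most t points.
-- Each of these is in turn a combination of t-pencils: for #S ≤ t ≤ k the
-- number of t-sets between S and a k-set K ⊇ S is positive and independent of K.
module Submission where

open import Defs
open import Data.Nat using (ℕ; _*_; _∸_; _≤_; _<_)
open import Data.Nat.Divisibility using (_∣_)
open import Data.Nat.Combinatorics using (_C_)
open import Data.Product using (_×_)
open import Relation.Binary.PropositionalEquality using (_≡_)

import Algebra.Apartness.Properties.HeytingCommutativeRing as HCR
import Algebra.Properties.AbelianGroup as AbelianGroup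
import Algebra.Properties.CommutativeSemigroup as CommutativeSemigroup
import Algebra.Properties.Ring as Ring
open import Algebra.Bundles using (CommutativeRing)
open import Data.Bool.Base using (Bool; true; false; _∧_; not; if_then_else_)
open import Data.Bool.Properties using (∧-zeroʳ)
open import Data.Fin.Subset using (Subset; inside; outside; ∣_∣; ⊥)
open import Data.Fin.Subset.Properties using (_⊆?_; ⊥⊆; ∣⊥∣≡0; p⊆q⇒∣p∣≤∣q∣)
open import Data.List.Base as List using (List; []; _∷_; _++_)
open import Data.List.Properties using (map-cong; map-∘; map-++)
open import Data.Nat.Base using (zero; suc; _+_; s≤s; z≤n; s≤s⁻¹)
open import Data.Nat.Combinatorics using (nCk≡nC[n∸k]; nCk+nC[k+1]≡[n+1]C[k+1])
open import Data.Nat.Divisibility using (divides-refl)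
open import Data.Nat.ListAction using () renaming (sum to ℕsum)
open import Data.Nat.ListAction.Properties using (sum-++)
open import Data.Nat.Properties as ℕ using (+-∸-assoc; +-suc; +-identityʳ; m≤n⇒∃[o]m+o≡n)
open import Data.Nat.Tactic.RingSolver using (solve-∀)
open import Data.Product using (∃; _,_; proj₁; proj₂)
open import Data.Sum using (inj₁; inj₂)
open import Data.Vec.Base using ([]; _∷_; tail)
open import Function.Base using (_∘_)
open import Level using (_⊔_)
open import Relation.Binary.Construct.Add.Infimum.NonStrict _≤_ using ()
  renaming ([_] to ≤₋[_])
open import Relation.Binary.PropositionalEquality as ≡ using (refl; cong; cong₂; subst)
open import Relation.Binary.Structures using (IsStrictPartialOrder)
open import Relation.Nullary using (¬_; yes; no; does; contradiction)
open import Relation.Nullary.Construct.Add.Infimum using () renaming ([_] to fin[_])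
open import Relation.Nullary.Decidable using (decidable-stable; dec-true)

-- Counting k-subsets

0<nCk : ∀ {n k} → k ≤ n → 0 < n C k
0<nCk {n}     {zero}  _         = s≤s z≤n
0<nCk {suc n} {suc k} (s≤s k≤n) = subst (0 <_) (nCk+nC[k+1]≡[n+1]C[k+1] n k)
  (ℕ.m≤n⇒m≤n+o _ (0<nCk k≤n))

size-cong : ∀ {n k} {f g : KSubset n k → Bool} → (∀ K → f K ≡ g K) → size f ≡ size g
size-cong {n} {k} f≗g =
  cong ℕsum (map-cong (λ K → cong (λ b → if b then 1 else 0) (f≗g K)) (kSubsets n k))

size-false : ∀ {n k} {f : KSubset n k → Bool} → (∀ K → f K ≡ false) → size f ≡ 0
size-false {n} {k} f≗false = ≡.trans (size-cong f≗false) (zeros (kSubsets n k))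
  where
  zeros : ∀ {a} {A : Set a} (xs : List A) → ℕsum (List.map (λ _ → 0) xs) ≡ 0
  zeros []       = refl
  zeros (_ ∷ xs) = zeros xs

size-zero : ∀ {n} (f : KSubset (suc n) 0 → Bool) → size f ≡ size (f ∘ without-0)
size-zero {n} f = cong ℕsum (≡.sym (map-∘ (kSubsets n 0)))

size-suc : ∀ {n k} (f : KSubset (suc n) (suc k) → Bool) →
           size f ≡ size (f ∘ with-0) + size (f ∘ without-0)
size-suc {n} {k} f = begin
  ℕsum (List.map g (List.map with-0 Ks ++ List.map without-0 Ls))
    ≡⟨ cong ℕsum (map-++ g (List.map with-0 Ks) _) ⟩
  ℕsum (List.map g (List.map with-0 Ks) ++ List.map g (List.map without-0 Ls))
    ≡⟨ sum-++ (List.map g (List.map with-0 Ks)) _ ⟩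
  ℕsum (List.map g (List.map with-0 Ks)) + ℕsum (List.map g (List.map without-0 Ls))
    ≡⟨ cong₂ (λ xs ys → ℕsum xs + ℕsum ys) (map-∘ Ks) (map-∘ Ls) ⟨
  size (f ∘ with-0) + size (f ∘ without-0) ∎
  where
  open ≡.≡-Reasoning
  g  = λ K → if f K then 1 else 0
  Ks = kSubsets n k
  Ls = kSubsets n (suc k)

size-true : ∀ n k → size {n} {k} (λ _ → true) ≡ n C k
size-true zero    zero    = refl
size-true zero    (suc k) = refl
size-true (suc n) zero    = ≡.trans (size-zero {n} (λ _ → true)) (size-true n 0)
size-true (suc n) (suc k) = begin
  size {suc n} {suc k} (λ _ → true) ≡⟨ size-suc {n} {k} (λ _ → true) ⟩
  size {n} {k} (λ _ → true) + size {n} {suc k} (λ _ → true)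
                                    ≡⟨ cong₂ _+_ (size-true n k) (size-true n (suc k)) ⟩
  n C k + n C suc k                 ≡⟨ nCk+nC[k+1]≡[n+1]C[k+1] n k ⟩
  suc n C suc k                     ∎
  where open ≡.≡-Reasoning

-- The extremal family and its size.

-- The set T consists of the first `m` of the `m + r` points, so that T ⊆ K and T ∩ K = ∅ can be
-- read off the vector by recursion on `m`.
allIn allOut : ∀ m {r} → Subset (m + r) → Bool
allIn zero    _       = true
allIn (suc m) (b ∷ K) = b ∧ allIn m K
allOut zero    _       = true
allOut (suc m) (b ∷ K) = not b ∧ allOut m K

-- The function f for T the first `suc t` points: the first point decides whether the remaining `t`
-- must all lie in K or all outside it.
allEqual : ∀ t {r} → Subset (suc t + r) → Bool
allEqual t (b ∷ K) = if b then allIn t K else allOut t K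

size-allIn : ∀ m r j → size {m + r} {m + j} (allIn m ∘ proj₁) ≡ r C j
size-allIn zero    r j = size-true r j
size-allIn (suc m) r j = begin
  size {suc m + r} {suc m + j} (allIn (suc m) ∘ proj₁)
    ≡⟨ size-suc {m + r} {m + j} (allIn (suc m) ∘ proj₁) ⟩
  size {m + r} {m + j} (allIn m ∘ proj₁) + size {m + r} {suc m + j} (λ _ → false)
    ≡⟨ cong₂ _+_ (size-allIn m r j) (size-false {m + r} {suc m + j} λ _ → refl) ⟩
  r C j + 0
    ≡⟨ +-identityʳ _ ⟩
  r C j ∎
  where open ≡.≡-Reasoning

size-allOut : ∀ m r k → size {m + r} {k} (allOut m ∘ proj₁) ≡ r C k
size-allOut zero    r k       = size-true r k
size-allOut (suc m) r zero    =
  ≡.trans (size-zero {m + r} (allOut (suc m) ∘ proj₁)) (size-allOut m r 0)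
size-allOut (suc m) r (suc k) = begin
  size {suc m + r} {suc k} (allOut (suc m) ∘ proj₁)
    ≡⟨ size-suc {m + r} {k} (allOut (suc m) ∘ proj₁) ⟩
  size {m + r} {k} (λ _ → false) + size {m + r} {suc k} (allOut m ∘ proj₁)
    ≡⟨ cong₂ _+_ (size-false {m + r} {k} λ _ → refl) (size-allOut m r (suc k)) ⟩
  r C suc k ∎
  where open ≡.≡-Reasoning

size-allEqual : ∀ t r j →
  size {suc t + r} {suc t + j} (allEqual t ∘ proj₁) ≡ r C j + r C (suc t + j)
size-allEqual t r j = ≡.trans (size-suc {t + r} {t + j} (allEqual t ∘ proj₁))
  (cong₂ _+_ (size-allIn t r j) (size-allOut t r (suc t + j)))

-- Counting the sets between two given sets.

-- The number of t-sets between an s-set and an (s + j)-set containing it.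
interval : ℕ → ℕ → ℕ → ℕ
interval zero    j t       = j C t
interval (suc s) j zero    = 0
interval (suc s) j (suc t) = interval s j t

0<interval : ∀ {s j t} → s ≤ t → t ≤ s + j → 0 < interval s j t
0<interval {zero}  _         t≤j       = 0<nCk t≤j
0<interval {suc s} (s≤s s≤t) (s≤s t≤k) = 0<interval {s} s≤t t≤k

interval-zero : ∀ s j → interval s (suc j) 0 ≡ interval s j 0
interval-zero zero    j = refl
interval-zero (suc s) j = refl

-- Pascal's rule: when K gains a point outside S, the intermediate sets split into those containing
-- the new point and those avoiding it.
interval-pascal : ∀ s j t →
  interval s j t + interval s j (suc t) ≡ interval s (suc j) (suc t)
interval-pascal zero    j t       = nCk+nC[k+1]≡[n+1]C[k+1] j t
interval-pascal (suc s) j zero    = ≡.sym (interval-zero s j)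
interval-pascal (suc s) j (suc t) = interval-pascal s j t

-- Induction on the points. A point in neither S nor K must be avoided by T, a point in both must
-- belong to T, a point of K alone leaves both choices and calls for Pascal's rule, and a point of S
-- alone makes both sides zero.
size-interval : ∀ {n} (S K : Subset n) t →
  size {n} {t} (λ T → does (proj₁ T ⊆? K) ∧ does (S ⊆? proj₁ T))
    ≡ (if does (S ⊆? K) then interval ∣ S ∣ (∣ K ∣ ∸ ∣ S ∣) t else 0)
size-interval [] [] zero    = refl
size-interval [] [] (suc t) = refl
size-interval {suc n} (outside ∷ S) (outside ∷ K) zero =
  ≡.trans (size-zero {n} _) (size-interval S K 0)
size-interval {suc n} (outside ∷ S) (outside ∷ K) (suc t) =
  ≡.trans (size-suc {n} {t} _)
    (cong₂ _+_ (size-false {n} {t} λ _ → refl) (size-interval S K (suc t)))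
size-interval {suc n} (outside ∷ S) (inside ∷ K) zero =
  ≡.trans (size-zero {n} _) (≡.trans (size-interval S K 0) step)
  where
  step : (if does (S ⊆? K) then interval ∣ S ∣ (∣ K ∣ ∸ ∣ S ∣) 0 else 0)
       ≡ (if does (S ⊆? K) then interval ∣ S ∣ (suc ∣ K ∣ ∸ ∣ S ∣) 0 else 0)
  step with S ⊆? K
  ... | no  _   = refl
  -- Since `∣ S ∣ ≤ ∣ K ∣`, the truncated difference grows by exactly one when K gains a point.
  ... | yes S⊆K rewrite +-∸-assoc 1 (p⊆q⇒∣p∣≤∣q∣ S⊆K) =
    ≡.sym (interval-zero ∣ S ∣ _)
size-interval {suc n} (outside ∷ S) (inside ∷ K) (suc t) =
  ≡.trans (size-suc {n} {t} _)
    (≡.trans (cong₂ _+_ (size-interval S K t) (size-interval S K (suc t))) step)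
  where
  step : (if does (S ⊆? K) then interval ∣ S ∣ (∣ K ∣ ∸ ∣ S ∣) t else 0)
       + (if does (S ⊆? K) then interval ∣ S ∣ (∣ K ∣ ∸ ∣ S ∣) (suc t) else 0)
       ≡ (if does (S ⊆? K) then interval ∣ S ∣ (suc ∣ K ∣ ∸ ∣ S ∣) (suc t) else 0)
  step with S ⊆? K
  ... | no  _   = refl
  ... | yes S⊆K rewrite +-∸-assoc 1 (p⊆q⇒∣p∣≤∣q∣ S⊆K) = interval-pascal ∣ S ∣ _ t
size-interval {suc n} (inside ∷ S) (outside ∷ K) zero =
  size-false {suc n} {0} λ { (outside ∷ T , _) → ∧-zeroʳ _ }
size-interval {suc n} (inside ∷ S) (outside ∷ K) (suc t) =
  size-false {suc n} {suc t} λ { (outside ∷ T , _) → ∧-zeroʳ _ ; (inside ∷ T , _) → refl }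
size-interval {suc n} (inside ∷ S) (inside ∷ K) zero =
  ≡.trans (size-false {suc n} {0} λ { (outside ∷ T , _) → ∧-zeroʳ _ }) (step (does (S ⊆? K)))
  where
  step : ∀ b → 0 ≡ (if b then 0 else 0)
  step false = refl
  step true  = refl
size-interval {suc n} (inside ∷ S) (inside ∷ K) (suc t) =
  ≡.trans (size-suc {n} {t} _)
    (≡.trans
      (cong₂ _+_ (size-interval S K t) (size-false {n} {suc t} λ _ → ∧-zeroʳ _))
      (+-identityʳ _))

-- Ordered-field arithmetic and finite sums.

module _ {c ℓ₁ ℓ₂} (ℝ : RealField c ℓ₁ ℓ₂) where

  open RealField ℝ hiding (zero) renaming
    (Carrier to R; _+_ to _⊕_; _*_ to _⊛_; refl to ≈-refl; sym to ≈-sym; trans to ≈-trans;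
     +-identityʳ to ⊕-identityʳ; _<_ to _≺_)
  open CommutativeRing commutativeRing using (ring; +-abelianGroup; +-commutativeSemigroup)
  open AbelianGroup +-abelianGroup using (⁻¹-∙-comm)
  open CommutativeSemigroup +-commutativeSemigroup using (interchange)
  open Ring ring using (-‿distribˡ-*; -‿involutive; [y-z]x≈yx-zx)
  open HCR heytingCommutativeRing using (1#0; x-0≈x)
  open import Relation.Binary.Reasoning.Setoid setoid
  private module ≺ = IsStrictPartialOrder <-isStrictPartialOrder

  0<1 : 0# ≺ 1#
  0<1 with #⇒<⊎> 1#0
  ... | inj₂ 0<1 = 0<1
  ... | inj₁ 1<0 = ≺.<-respʳ-≈ -1*-1≈1 (*-pos 0<-1 0<-1)
    where
    0<-1 : 0# ≺ - 1#
    0<-1 = ≺.<-respˡ-≈ (-‿inverseʳ 1#) (≺.<-respʳ-≈ (+-identityˡ _) (+-monoˡ-< (- 1#) 1<0))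
    -1*-1≈1 : - 1# ⊛ - 1# ≈ 1#
    -1*-1≈1 = ≈-trans (≈-sym (-‿distribˡ-* 1# (- 1#)))
                (≈-trans (-‿cong (*-identityˡ _)) (-‿involutive 1#))

  0<[1+n]·1 : ∀ n → 0# ≺ suc n · 1#
  0<[1+n]·1 zero    = ≺.<-respʳ-≈ (≈-sym (⊕-identityʳ 1#)) 0<1
  0<[1+n]·1 (suc n) = ≺.trans (0<[1+n]·1 n)
    (≺.<-respˡ-≈ (+-identityˡ _) (+-monoˡ-< (suc n · 1#) 0<1))

  -- Positive multiples of 1 are apart from 0, hence invertible; this permits division by the
  -- interval count.
  inverse : ∀ {n} → 0 < n → ∃ λ x → x ⊛ (n · 1#) ≈ 1#
  inverse {suc n} _ with #⇒invertible (#-sym (<⇒# (0<[1+n]·1 n)))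
  ... | x , x*n≈1 , _ = x , ≈-trans (*-congˡ (≈-sym (x-0≈x _))) x*n≈1

  1≉0 : ¬ 1# ≈ 0#
  1≉0 1≈0 = #-irrefl 1≈0 1#0

  χ : Bool → R
  χ b = if b then 1# else 0#

  χ-∧ : ∀ a b → χ a ⊛ χ b ≈ χ (b ∧ a)
  χ-∧ true  true  = *-identityˡ _
  χ-∧ true  false = zeroʳ _
  χ-∧ false true  = zeroˡ _
  χ-∧ false false = zeroˡ _

  module _ {a} {A : Set a} where

    sum-cong : ∀ {f g : A → R} → (∀ x → f x ≈ g x) → ∀ xs → sum ℝ f xs ≈ sum ℝ g xs
    sum-cong f≈g []       = ≈-refl
    sum-cong f≈g (x ∷ xs) = +-cong (f≈g x) (sum-cong f≈g xs)

    sum-0 : ∀ (xs : List A) → sum ℝ (λ _ → 0#) xs ≈ 0#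
    sum-0 []       = ≈-refl
    sum-0 (x ∷ xs) = ≈-trans (+-identityˡ _) (sum-0 xs)

    sum-- : ∀ (f g : A → R) xs → sum ℝ (λ x → f x - g x) xs ≈ sum ℝ f xs - sum ℝ g xs
    sum-- f g []       = ≈-sym (-‿inverseʳ 0#)
    sum-- f g (x ∷ xs) = begin
      (f x - g x) ⊕ sum ℝ (λ x → f x - g x) xs ≈⟨ +-congˡ (sum-- f g xs) ⟩
      (f x - g x) ⊕ (F - G)                    ≈⟨ interchange _ _ _ _ ⟩
      (f x ⊕ F) ⊕ (- g x ⊕ - G)                ≈⟨ +-congˡ (⁻¹-∙-comm _ _) ⟩
      (f x ⊕ F) - (g x ⊕ G)                    ∎
      where
      F = sum ℝ f xs
      G = sum ℝ g xs

    *-distribˡ-sum : ∀ y (f : A → R) xs → sum ℝ (λ x → y ⊛ f x) xs ≈ y ⊛ sum ℝ f xs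
    *-distribˡ-sum y f []       = ≈-sym (zeroʳ y)
    *-distribˡ-sum y f (x ∷ xs) =
      ≈-trans (+-congˡ (*-distribˡ-sum y f xs)) (≈-sym (distribˡ y _ _))

    sum-χ : ∀ (p : A → Bool) xs →
            sum ℝ (χ ∘ p) xs ≈ ℕsum (List.map (λ x → if p x then 1 else 0) xs) · 1#
    sum-χ p []       = ≈-refl
    sum-χ p (x ∷ xs) with p x
    ... | true  = +-congˡ (sum-χ p xs)
    ... | false = ≈-trans (+-identityˡ _) (sum-χ p xs)

  -- Combinations of pencils of mixed sizes

  contains : ∀ {n} → Subset n → Subset n → R
  contains S K = χ (does (S ⊆? K))

  -- These are functions on all subsets, so that induction on the points need not track `k`.
  -- Differences suffice to generate every integer combination. The strict bound leaves only the
  -- zero function at `d = 0`, where the induction for `degree-alternating` starts.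
  data DegreeBelow (d : ℕ) {n} : (Subset n → R) → Set (c ⊔ ℓ₁) where
    zero     : DegreeBelow d (λ _ → 0#)
    monomial : ∀ S → ∣ S ∣ < d → DegreeBelow d (contains S)
    _−_      : ∀ {g h} → DegreeBelow d g → DegreeBelow d h → DegreeBelow d (λ K → g K - h K)
    resp     : ∀ {g h} → (∀ K → g K ≈ h K) → DegreeBelow d g → DegreeBelow d h

  contains-combination : ∀ {n k t} (S : Subset n) → ∣ S ∣ ≤ t → t ≤ k →
                         IsPencilCombination ℝ {n} {k} (contains S ∘ proj₁) t
  contains-combination {n} {k} {t} S s≤t t≤k = coefficient , correct
    where
    N = interval ∣ S ∣ (k ∸ ∣ S ∣) t
    N⁻¹ = inverse (0<interval {∣ S ∣} s≤t (ℕ.≤-trans t≤k (ℕ.m≤n+m∸n k ∣ S ∣)))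

    coefficient : KSubset n t → R
    coefficient (T , _) = proj₁ N⁻¹ ⊛ contains S T

    normalise : ∀ b → proj₁ N⁻¹ ⊛ ((if b then N else 0) · 1#) ≈ χ b
    normalise true  = proj₂ N⁻¹
    normalise false = zeroʳ _

    correct : ∀ K → contains S (proj₁ K) ≈
                    sum ℝ (λ T → coefficient T ⊛ pencil ℝ T K) (kSubsets n t)
    -- Matching on `refl` replaces `k` by `∣ K ∣`, which makes `N` the count in `size-interval`.
    correct (K , refl) = ≈-sym (begin
      sum ℝ (λ T → (proj₁ N⁻¹ ⊛ contains S (proj₁ T)) ⊛ contains (proj₁ T) K) Ts
        ≈⟨ sum-cong (λ T → ≈-trans (*-assoc _ _ _)
             (*-congˡ (χ-∧ (does (S ⊆? proj₁ T)) (does (proj₁ T ⊆? K))))) Ts ⟩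
      sum ℝ (λ T → proj₁ N⁻¹ ⊛ χ (between T)) Ts
        ≈⟨ *-distribˡ-sum _ (χ ∘ between) Ts ⟩
      proj₁ N⁻¹ ⊛ sum ℝ (χ ∘ between) Ts
        ≈⟨ *-congˡ (sum-χ between Ts) ⟩
      proj₁ N⁻¹ ⊛ (size between · 1#)
        ≡⟨ cong (λ x → proj₁ N⁻¹ ⊛ (x · 1#)) (size-interval S K t) ⟩
      proj₁ N⁻¹ ⊛ ((if does (S ⊆? K) then N else 0) · 1#)
        ≈⟨ normalise (does (S ⊆? K)) ⟩
      contains S K ∎)
      where
      Ts = kSubsets n t
      between : KSubset n t → Bool
      between (T , _) = does (T ⊆? K) ∧ does (S ⊆? T)

  combination : ∀ {n k t} {g : Subset n → R} → t ≤ k → DegreeBelow (suc t) g →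
                IsPencilCombination ℝ {n} {k} (g ∘ proj₁) t
  combination {n} {t = t} t≤k zero =
    (λ _ → 0#) , λ K →
      ≈-sym (≈-trans (sum-cong (λ T → zeroˡ _) (kSubsets n t)) (sum-0 (kSubsets n t)))
  combination t≤k (monomial S s<1+t) = contains-combination S (s≤s⁻¹ s<1+t) t≤k
  combination {n} {t = t} t≤k (p − q)
    with a , ga ← combination t≤k p | b , hb ← combination t≤k q =
    (λ T → a T - b T) , λ K → ≈-sym (begin
      sum ℝ (λ T → (a T - b T) ⊛ pencil ℝ T K) (kSubsets n t)
        ≈⟨ sum-cong (λ T → [y-z]x≈yx-zx (pencil ℝ T K) (a T) (b T)) (kSubsets n t) ⟩
      sum ℝ (λ T → a T ⊛ pencil ℝ T K - b T ⊛ pencil ℝ T K) (kSubsets n t)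
        ≈⟨ sum-- (λ T → a T ⊛ pencil ℝ T K) (λ T → b T ⊛ pencil ℝ T K) (kSubsets n t) ⟩
      _ - _
        ≈⟨ +-cong (≈-sym (ga K)) (-‿cong (≈-sym (hb K))) ⟩
      _ ∎)
  combination t≤k (resp g≈h p) with a , ga ← combination t≤k p =
    a , λ K → ≈-trans (≈-sym (g≈h (proj₁ K))) (ga K)

  -- Degree bounds by splitting off the first point.

  branch : ∀ {n} → (Subset n → R) → (Subset n → R) → Subset (suc n) → R
  branch g h (b ∷ K) = if b then g K else h K

  degree-tail : ∀ {d n} {g : Subset n → R} → DegreeBelow d g → DegreeBelow d (g ∘ tail)
  degree-tail zero           = zero
  degree-tail (monomial S p) = resp (λ { (b ∷ K) → ≈-refl }) (monomial (outside ∷ S) p)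
  degree-tail (p − q)        = degree-tail p − degree-tail q
  degree-tail (resp g≈h p)   = resp (g≈h ∘ tail) (degree-tail p)

  -- Multiplying by the indicator of the first point adds that point to every focus, which costs one
  -- degree.
  degree-head : ∀ {d n} {g : Subset n → R} →
                DegreeBelow d g → DegreeBelow (suc d) (branch g (λ _ → 0#))
  degree-head zero           = resp (λ { (inside ∷ K) → ≈-refl ; (outside ∷ K) → ≈-refl }) zero
  degree-head (monomial S p) =
    resp (λ { (inside ∷ K) → ≈-refl ; (outside ∷ K) → ≈-refl }) (monomial (inside ∷ S) (s≤s p))
  degree-head (p − q)        =
    resp (λ { (inside ∷ K) → ≈-refl ; (outside ∷ K) → -‿inverseʳ 0# }) (degree-head p − degree-head q)
  degree-head (resp g≈h p)   =
    resp (λ { (inside ∷ K) → g≈h K ; (outside ∷ K) → ≈-refl }) (degree-head p)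

  -- With b the indicator of the first point, branch g h = h − b (h − g).
  degree-branch : ∀ {d n} {g h : Subset n → R} → DegreeBelow (suc d) h →
                  DegreeBelow d (λ K → h K - g K) → DegreeBelow (suc d) (branch g h)
  degree-branch {g = g} {h} p q = resp
    (λ { (inside ∷ K) → h-[h-g]≈g (h K) (g K) ; (outside ∷ K) → x-0≈x (h K) })
    (degree-tail p − degree-head q)
    where
    h-[h-g]≈g : ∀ x y → x - (x - y) ≈ y
    h-[h-g]≈g x y = begin
      x - (x - y)       ≈⟨ +-congˡ (⁻¹-∙-comm x (- y)) ⟨
      x ⊕ (- x ⊕ - - y) ≈⟨ +-assoc x (- x) (- - y) ⟨
      (x - x) ⊕ - - y   ≈⟨ +-cong (-‿inverseʳ x) (-‿involutive y) ⟩
      0# ⊕ y            ≈⟨ +-identityˡ y ⟩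
      y                 ∎

  -- Each point of T contributes a factor 1 - b, with b its indicator, and so raises the degree by
  -- at most one; the empty product is the pencil at `⊥`.
  degree-allOut : ∀ m {r d} → m < d → DegreeBelow d (χ ∘ allOut m {r})
  degree-allOut zero    {r} 0<d = resp
    (λ K → reflexive (cong χ (dec-true (⊥ ⊆? K) ⊥⊆)))
    (monomial ⊥ (subst (_< _) (≡.sym (∣⊥∣≡0 r)) 0<d))
  degree-allOut (suc m) (s≤s m<d) = resp
    (λ { (inside ∷ K) → ≈-refl ; (outside ∷ K) → ≈-refl })
    (degree-branch {g = λ _ → 0#} (degree-allOut m (ℕ.m≤n⇒m≤1+n m<d)) (degree-allOut m m<d − zero))

  sign : ℕ → R
  sign zero    = 1#
  sign (suc m) = - sign m

  sign-even : ∀ q → sign (q * 2) ≈ 1#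
  sign-even zero    = ≈-refl
  sign-even (suc q) = ≈-trans (-‿involutive _) (sign-even q)

  -- The top terms cancel. Off the first point the function is h = [T ∩ K = ∅] for the other `m`
  -- points; on it, it is g = `sign m` times [T ⊆ K] for the same points. Then h - g is the function
  -- of the induction hypothesis, so `degree-branch` applies.
  degree-alternating : ∀ m {r} →
    DegreeBelow m (λ K → χ (allOut m {r} K) - sign m ⊛ χ (allIn m K))
  degree-alternating zero    =
    resp (λ K → ≈-sym (≈-trans (+-congˡ (-‿cong (*-identityˡ 1#))) (-‿inverseʳ 1#))) zero
  degree-alternating (suc m) = resp
    (λ { (inside ∷ K) → inside-case (χ (allIn m K))
       ; (outside ∷ K) → ≈-sym (≈-trans (+-congˡ (-‿cong (zeroʳ _))) (x-0≈x _)) })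
    (degree-branch (degree-allOut m ℕ.≤-refl) (degree-alternating m))
    where
    inside-case : ∀ x → sign m ⊛ x ≈ 0# - (- sign m) ⊛ x
    inside-case x = ≈-sym (begin
      0# - (- sign m) ⊛ x ≈⟨ +-identityˡ _ ⟩
      - ((- sign m) ⊛ x)  ≈⟨ -‿cong (-‿distribˡ-* (sign m) x) ⟨
      - - (sign m ⊛ x)    ≈⟨ -‿involutive _ ⟩
      sign m ⊛ x          ∎)

  -- The two branches at the first point differ by the alternating function on the other `t` points,
  -- whose sign is 1 because `t` is even.
  degree-allEqual : ∀ {t r} → 2 ∣ t → DegreeBelow (suc t) (χ ∘ allEqual t {r})
  degree-allEqual {t} (divides-refl q) = resp
    (λ { (inside ∷ K) → ≈-refl ; (outside ∷ K) → ≈-refl })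
    (degree-branch {g = χ ∘ allIn t} (degree-allOut t ℕ.≤-refl)
      (resp (λ K → +-congˡ (-‿cong (≈-trans (*-congʳ (sign-even q)) (*-identityˡ _))))
        (degree-alternating t)))

  -- From a pencil combination to a bound on the minimum size.

  isZero⇒size≡0 : ∀ {n k} (f : KSubset n k → Bool) → IsZero ℝ (⟦_⟧ ℝ f) → size f ≡ 0
  isZero⇒size≡0 f f≈0 = size-false λ K → value (f K) (f≈0 K)
    where
    value : ∀ b → χ b ≈ 0# → b ≡ false
    value false _   = refl
    value true  1≈0 = contradiction 1≈0 1≉0

  -- The exact degree exists only classically, but m ≤ s is decidable.
  m₁-≤ : ∀ {n k t m s} (f : KSubset n k → Bool) → IsPencilCombination ℝ (⟦_⟧ ℝ f) t →
         size f ≡ s → 0 < s → IsM₁ ℝ n k t m → m ≤ s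
  m₁-≤ {m = m} {s} f p refl 0<s (_ , minimal) =
    decidable-stable (m ℕ.≤? s) λ m≰s →
      ¬¬minimum (IsPencilCombination ℝ (⟦_⟧ ℝ f)) p λ (d , min) →
        m≰s (minimal s (f , f≢0 , (fin[ d ] , nonZero f≢0 min , ≤₋[ proj₂ min _ p ]) , refl))
    where
    f≢0 : ¬ IsZero ℝ (⟦_⟧ ℝ f)
    f≢0 f≈0 = ℕ.<⇒≢ 0<s (≡.sym (isZero⇒size≡0 f f≈0))

  m₁-≤-allEqual : ∀ {t r j m} → 2 ∣ t → j ≤ r → IsM₁ ℝ (suc t + r) (suc t + j) t m →
                  m ≤ r C j + r C (suc t + j)
  m₁-≤-allEqual {t} {r} {j} 2∣t j≤r = m₁-≤ (allEqual t ∘ proj₁)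
    (combination (ℕ.m≤n⇒m≤1+n (ℕ.m≤m+n t j)) (degree-allEqual 2∣t))
    (size-allEqual t r j)
    -- As `j ≤ r`, some K contains T, so the function is not zero.
    (ℕ.m≤n⇒m≤n+o _ (0<nCk j≤r))

corollary5 : ∀ {c ℓ₁ ℓ₂} (ℝ : RealField c ℓ₁ ℓ₂) (k t : ℕ) → t < k → 2 ∣ t →
    (∀ m → IsM₁ ℝ (2 * k) k t m → m ≤ 2 * ((2 * k ∸ t ∸ 1) C k))
    × 2 * ((2 * k ∸ t ∸ 1) C k) ≡ 2 * ((2 * k ∸ t ∸ 1) C (k ∸ t ∸ 1))
corollary5 ℝ k t t<k 2∣t with m≤n⇒∃[o]m+o≡n t<k
-- Here `k` becomes `suc t + j`, so `j` is k - t - 1.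
... | j , refl = bound , cong (2 *_) symmetric
  where
  open ≡.≡-Reasoning
  r = 2 * k ∸ t ∸ 1

  -- Taking the `suc t` points of T out of the 2k points leaves k + j.
  2k≡ : ∀ t j → 2 * (suc t + j) ≡ suc t + (suc t + j + j)
  2k≡ = solve-∀

  1+t+x∸t∸1≡x : ∀ x → suc t + x ∸ t ∸ 1 ≡ x
  1+t+x∸t∸1≡x x = begin
    suc t + x ∸ t ∸ 1   ≡⟨ cong (λ y → y ∸ t ∸ 1) (+-suc t x) ⟨
    t + suc x ∸ t ∸ 1   ≡⟨ cong (_∸ 1) (ℕ.m+n∸m≡n t (suc x)) ⟩
    x                   ∎

  r≡k+j : r ≡ k + j
  r≡k+j = ≡.trans (cong (λ n → n ∸ t ∸ 1) (2k≡ t j)) (1+t+x∸t∸1≡x (k + j))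

  symmetric : r C k ≡ r C (k ∸ t ∸ 1)
  symmetric = begin
    r C k                 ≡⟨ cong (_C k) r≡k+j ⟩
    (k + j) C k           ≡⟨ nCk≡nC[n∸k] (ℕ.m≤m+n k j) ⟩
    (k + j) C (k + j ∸ k) ≡⟨ cong ((k + j) C_) (ℕ.m+n∸m≡n k j) ⟩
    (k + j) C j           ≡⟨ cong₂ _C_ r≡k+j (1+t+x∸t∸1≡x j) ⟨
    r C (k ∸ t ∸ 1)       ∎

  -- The k-sets containing T and those disjoint from T are equally many, by the symmetry of the
  -- binomial coefficient at k + j; this gives the factor 2.
  size≡ : (k + j) C j + (k + j) C k ≡ 2 * (r C k)
  size≡ = begin
    (k + j) C j + (k + j) C k ≡⟨ cong₂ (λ x y → x C y + x C k) r≡k+j (1+t+x∸t∸1≡x j) ⟨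
    r C (k ∸ t ∸ 1) + r C k   ≡⟨ cong (_+ r C k) symmetric ⟨
    r C k + r C k             ≡⟨ cong (r C k +_) (+-identityʳ (r C k)) ⟨
    2 * (r C k)               ∎

  bound : ∀ m → IsM₁ ℝ (2 * k) k t m → m ≤ 2 * (r C k)
  bound m isM₁ = subst (m ≤_) size≡
    (m₁-≤-allEqual ℝ 2∣t (ℕ.m≤n+m j k) (subst (λ n → IsM₁ ℝ n k t m) (2k≡ t j) isM₁))
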